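{- There is an absolute constant $C>0$ such that for all integers $2\le k\le n$ there exists a map $\phi:\mathcal{H}_n^k\to\mathcal{H}_k(n)$ such that for all $\vec x,\vec y\in\mathcal{H}_n^k$, \[\tfrac12\operatorname{Ham}(\vec x,\vec y)\le \operatorname{Ham}(\phi(\vec x),\phi(\vec y))\le C\log n\,\log k\;\operatorname{Ham}(\vec x,\vec y).\]
   Context: $\mathcal{H}_n^k$ is the set of vectors in $\{0,1\}^n$ with exactly $k$ coordinates equal to $1$. $\mathcal{H}_k(n)$ is the set of $k$-dimensional vectors with entries from $[n]=\{1,\dots,n\}$. For two vectors $\vec x,\vec y$ of the same dimension, $\operatorname{Ham}(\vec x,\vec y)=|\{i: x_i\ne y_i\}|$. -}

module Defs where

open import Data.Nat using (ℕ; zero; suc; _+_)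
open import Data.Fin using (Fin; zero; suc)
open import Data.Bool using (Bool; true; false; if_then_else_)
open import Data.Product using (Σ)
open import Relation.Binary.PropositionalEquality using (_≡_)
open import Relation.Binary.Definitions using (DecidableEquality)
open import Relation.Nullary using (does)

weight : ∀ {n} → (Fin n → Bool) → ℕ
weight {zero} x = 0
weight {suc n} x = (if x zero then 1 else 0) + weight (λ i → x (suc i))

H[_]^_ : ℕ → ℕ → Set
H[ n ]^ k = Σ (Fin n → Bool) (λ x → weight x ≡ k)

H_⟨_⟩ : ℕ → ℕ → Set
H_⟨_⟩ k n = Fin k → Fin n

Ham : ∀ {A : Set} → DecidableEquality A → ∀ {m} → (Fin m → A) → (Fin m → A) → ℕ
Ham _≟_ {zero} x y = 0
Ham _≟_ {suc m} x y =
  (if does (x zero ≟ y zero) then 0 else 1) + Ham _≟_ (λ i → x (suc i)) (λ i → y (suc i))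

{-# OPTIONS --safe #-}
module Submission where

-- φ lists the elements of a k-set A in an order that changes in O(log n log k) places when one
-- element is added. Cut the universe into halves; lists of lengths p and q for the two halves are
-- combined by giving slots [0, p) to the first and [p, p + q) to the second, the latter through a
-- bijection [p, p + q) → [0, q). That bijection must change in O(log k) places when p or q changes
-- by one, and then the costs add up along the log n levels of the universe.
--
-- The bijection comes from the binary tree of residues modulo powers of 2: two intervals of equal
-- length have, in each residue class, cardinalities that differ by at most one. So each node can match
-- everything below it except at most one misfit, which its parent matches with the misfit of the
-- sibling when they have opposite signs. Moving an endpoint affects only one path of the tree.
--
-- The lower bound holds because φ(A) contains every element of A.

open import Defs
open import Data.Bool using (Bool; true; false; not; _∧_; _∨_; if_then_else_; T)
open import Data.Bool.Properties using () renaming (_≟_ to _≟B_)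
open import Data.Fin using (Fin; zero; suc; toℕ; fromℕ<)
open import Data.Fin.Properties using (toℕ-injective; toℕ-fromℕ<; toℕ<n) renaming (_≟_ to _≟F_)
open import Data.List using (List; []; _∷_; _++_; map; length; upTo; allFin)
open import Data.List.Properties using (length-++; length-map; length-upTo; length-tabulate)
open import Data.List.Membership.Propositional using (_∈_; _∉_)
open import Data.List.Membership.Propositional.Properties
  using (∈-map⁺; ∈-++⁺ˡ; ∈-++⁺ʳ; ∈-upTo⁺; ∈-allFin)
open import Data.List.Relation.Unary.Any using (here; there)
open import Data.Nat
  using (ℕ; zero; suc; _+_; _*_; _∸_; _^_; _≤_; _<_; _<ᵇ_; _<?_; _≟_;
    z≤n; s≤s; s≤s⁻¹; NonZero; >-nonZero; ⌊_/2⌋; ⌈_/2⌉)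
open import Data.List.Membership.DecPropositional _≟_ using (_∈?_)
open import Data.Nat.DivMod using (_mod_; m<n⇒m%n≡m)
open import Data.Nat.Logarithm using (⌈log₂_⌉; ⌈log₂⌉-mono-≤)
open import Data.Nat.Logarithm.Core using (⌈log2⌉)
open import Data.Nat.Induction using (<-wellFounded)
open import Data.Nat.Properties hiding (_≟_; _<?_)
open import Data.Nat.Tactic.RingSolver using (solve-∀)
open import Data.Product using (Σ; ∃; _×_; _,_; proj₁; proj₂)
open import Data.Sum using (_⊎_; inj₁; inj₂)
import Data.Sum as Sum
open import Function using (_∘_; id)
open import Induction.WellFounded using (Acc; acc)
open import Relation.Binary.PropositionalEquality
open import Relation.Nullary using (does; yes; no; contradiction)
open import Relation.Nullary.Decidable using (dec-true; dec-false)

-- Splitting by parity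

join : ℕ ⊎ ℕ → ℕ
join (inj₁ y) = y + y
join (inj₂ y) = suc (y + y)

half : ℕ → ℕ ⊎ ℕ
half zero = inj₁ 0
half (suc x) with half x
... | inj₁ y = inj₂ y
... | inj₂ y = inj₁ (suc y)

join-half : ∀ x → join (half x) ≡ x
join-half zero = refl
join-half (suc x) with half x | join-half x
... | inj₁ y | eq = cong suc eq
... | inj₂ y | eq = cong suc (trans (+-suc y y) eq)

half-double : ∀ y → half (y + y) ≡ inj₁ y
half-double zero = refl
half-double (suc y) rewrite +-suc y y | half-double y = refl

half-join : ∀ s → half (join s) ≡ s
half-join (inj₁ y) = half-double y
half-join (inj₂ y) rewrite half-double y = refl

-- The even members of [0, q) number ⌈q/2⌉ and the odd ones ⌊q/2⌋. This is the source of the pairing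
-- of ceilings with even and floors with odd numbers below.
double<ᵇ : ∀ y q → (y + y <ᵇ q) ≡ (y <ᵇ ⌈ q /2⌉)
double<ᵇ zero zero = refl
double<ᵇ zero (suc q) = refl
double<ᵇ (suc y) zero = refl
double<ᵇ (suc y) (suc zero) = refl
double<ᵇ (suc y) (suc (suc q)) rewrite +-suc y y = double<ᵇ y q

suc-double<ᵇ : ∀ y q → (suc (y + y) <ᵇ q) ≡ (y <ᵇ ⌊ q /2⌋)
suc-double<ᵇ y zero = refl
suc-double<ᵇ zero (suc zero) = refl
suc-double<ᵇ zero (suc (suc q)) = refl
suc-double<ᵇ (suc y) (suc zero) = refl
suc-double<ᵇ (suc y) (suc (suc q)) rewrite +-suc y y = suc-double<ᵇ y q

inside : ℕ → ℕ → ℕ → Bool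
inside c d x = not (x <ᵇ c) ∧ (x <ᵇ d)

swap : ℕ → ℕ → ℕ → ℕ
swap a b x with x ≟ a | x ≟ b
... | yes _ | _ = b
... | no _ | yes _ = a
... | no _ | no _ = x

swap-left : ∀ a b → swap a b a ≡ b
swap-left a b with a ≟ a
... | yes _ = refl
... | no a≢a = contradiction refl a≢a

swap-right : ∀ a b → swap a b b ≡ a
swap-right a b with b ≟ a | b ≟ b
... | yes b≡a | _ = b≡a
... | no _ | yes _ = refl
... | no _ | no b≢b = contradiction refl b≢b

swap-other : ∀ {a b x} → x ≢ a → x ≢ b → swap a b x ≡ x
swap-other {a} {b} {x} x≢a x≢b with x ≟ a | x ≟ b
... | yes x≡a | _ = contradiction x≡a x≢a
... | no _ | yes x≡b = contradiction x≡b x≢b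
... | no _ | no _ = refl

swap-involutive : ∀ a b x → swap a b (swap a b x) ≡ x
swap-involutive a b x with x ≟ a | x ≟ b
... | yes refl | _ = swap-right x b
... | no _ | yes refl = swap-left a x
... | no x≢a | no x≢b = swap-other x≢a x≢b

-- Matching two intervals

-- plus a: P has the extra point a; minus a: Q has it.
data Misfit : Set where
  none : Misfit
  plus minus : ℕ → Misfit

Differ : (P Q : ℕ → Bool) → Misfit → Set
Differ P Q none = ∀ x → P x ≡ Q x
Differ P Q (plus a) = P a ≡ true × Q a ≡ false × (∀ x → x ≢ a → P x ≡ Q x)
Differ P Q (minus a) = P a ≡ false × Q a ≡ true × (∀ x → x ≢ a → P x ≡ Q x)

-- Opposite misfits disappear, because `crossing` pairs them; a lone misfit moves up and is renamed
-- in the parent's numbering. Equal signs are excluded by `Compatible`, so `none` is a filler there.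
merge : Misfit → Misfit → Misfit
merge none none = none
merge none (plus y) = plus (suc (y + y))
merge none (minus y) = minus (suc (y + y))
merge (plus x) none = plus (x + x)
merge (minus x) none = minus (x + x)
merge (plus _) (minus _) = none
merge (minus _) (plus _) = none
merge (plus _) (plus _) = none
merge (minus _) (minus _) = none

crossing : Misfit → Misfit → ℕ → ℕ
crossing (plus x) (minus y) = swap (x + x) (suc (y + y))
crossing (minus x) (plus y) = swap (x + x) (suc (y + y))
crossing none _ = id
crossing (plus _) none = id
crossing (plus _) (plus _) = id
crossing (minus _) none = id
crossing (minus _) (minus _) = id

moved : Misfit → Misfit → List ℕ
moved (plus x) (minus y) = (x + x) ∷ suc (y + y) ∷ []
moved (minus x) (plus y) = (x + x) ∷ suc (y + y) ∷ []
moved none _ = []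
moved (plus _) none = []
moved (plus _) (plus _) = []
moved (minus _) none = []
moved (minus _) (minus _) = []

crossing-involutive : ∀ m n x → crossing m n (crossing m n x) ≡ x
crossing-involutive (plus x) (minus y) = swap-involutive _ _
crossing-involutive (minus x) (plus y) = swap-involutive _ _
crossing-involutive none _ _ = refl
crossing-involutive (plus _) none _ = refl
crossing-involutive (plus _) (plus _) _ = refl
crossing-involutive (minus _) none _ = refl
crossing-involutive (minus _) (minus _) _ = refl

crossing-fixes : ∀ m n {x} → x ∉ moved m n → crossing m n x ≡ x
crossing-fixes (plus x) (minus y) x∉ = swap-other (x∉ ∘ here) (x∉ ∘ there ∘ here)
crossing-fixes (minus x) (plus y) x∉ = swap-other (x∉ ∘ here) (x∉ ∘ there ∘ here)
crossing-fixes none _ _ = refl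
crossing-fixes (plus _) none _ = refl
crossing-fixes (plus _) (plus _) _ = refl
crossing-fixes (minus _) none _ = refl
crossing-fixes (minus _) (minus _) _ = refl

length-moved : ∀ m n → length (moved m n) ≤ 2
length-moved (plus x) (minus y) = ≤-refl
length-moved (minus x) (plus y) = ≤-refl
length-moved none _ = z≤n
length-moved (plus _) none = z≤n
length-moved (plus _) (plus _) = z≤n
length-moved (minus _) none = z≤n
length-moved (minus _) (minus _) = z≤n

data Compatible : Misfit → Misfit → Set where
  none-any : ∀ {n} → Compatible none n
  plus-none : ∀ {x} → Compatible (plus x) none
  minus-none : ∀ {x} → Compatible (minus x) none
  plus-minus : ∀ {x y} → Compatible (plus x) (minus y)
  minus-plus : ∀ {x y} → Compatible (minus x) (plus y)

module _ (P Q : ℕ → Bool) where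

  by-halves : (R : ℕ → Set) → (∀ y → R (y + y)) → (∀ y → R (suc (y + y))) → ∀ x → R x
  by-halves R ev od x = subst R (join-half x) (go (half x))
    where
    go : ∀ s → R (join s)
    go (inj₁ y) = ev y
    go (inj₂ y) = od y

  agree-except : ∀ {a b} →
    (∀ y → y + y ≢ a → P (y + y) ≡ Q (y + y)) →
    (∀ y → suc (y + y) ≢ b → P (suc (y + y)) ≡ Q (suc (y + y))) →
    ∀ x → x ≢ a → x ≢ b → P x ≡ Q x
  agree-except ev od = by-halves _ (λ y ≢a _ → ev y ≢a) (λ y _ ≢b → od y ≢b)

  exchange : ∀ {a b} → P a ≡ Q b → P b ≡ Q a →
    (∀ x → x ≢ a → x ≢ b → P x ≡ Q x) → ∀ x → P x ≡ Q (swap a b x)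
  exchange {a} {b} ab ba rest x with x ≟ a | x ≟ b
  ... | yes refl | _ = ab
  ... | no _ | yes refl = ba
  ... | no x≢a | no x≢b = rest x x≢a x≢b

  -- For opposite misfits a and b, `P` and `Q` are opposite at both points, and `P a` agrees with
  -- `Q b`; swapping a and b inside `Q` therefore repairs both. In the other cases `crossing` is the
  -- identity and at most one child has a misfit to pass on.
  differ-merge : ∀ {m n} → Compatible m n →
    Differ (P ∘ join ∘ inj₁) (Q ∘ join ∘ inj₁) m →
    Differ (P ∘ join ∘ inj₂) (Q ∘ join ∘ inj₂) n →
    Differ P (Q ∘ crossing m n) (merge m n)
  differ-merge (none-any {none}) e o = by-halves _ e o
  differ-merge (none-any {plus y}) e (p , q , o) =
    p , q , by-halves _ (λ z _ → e z) (λ z ≢y → o z (≢y ∘ cong (λ w → suc (w + w))))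
  differ-merge (none-any {minus y}) e (p , q , o) =
    p , q , by-halves _ (λ z _ → e z) (λ z ≢y → o z (≢y ∘ cong (λ w → suc (w + w))))
  differ-merge plus-none (p , q , e) o =
    p , q , by-halves _ (λ z ≢y → e z (≢y ∘ cong (λ w → w + w))) (λ z _ → o z)
  differ-merge minus-none (p , q , e) o =
    p , q , by-halves _ (λ z ≢y → e z (≢y ∘ cong (λ w → w + w))) (λ z _ → o z)
  differ-merge plus-minus (p , q , e) (p′ , q′ , o) =
    exchange (trans p (sym q′)) (trans p′ (sym q))
      (agree-except (λ y ≢a → e y (≢a ∘ cong (λ w → w + w)))
                    (λ y ≢b → o y (≢b ∘ cong (λ w → suc (w + w)))))
  differ-merge minus-plus (p , q , e) (p′ , q′ , o) =
    exchange (trans p (sym q′)) (trans p′ (sym q))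
      (agree-except (λ y ≢a → e y (≢a ∘ cong (λ w → w + w)))
                    (λ y ≢b → o y (≢b ∘ cong (λ w → suc (w + w)))))

-- Recursive matching along parities

interleave : (ℕ → ℕ) → (ℕ → ℕ) → ℕ → ℕ
interleave f g = join ∘ Sum.map f g ∘ half

-- At height 0 only the point 0 remains: the first argument tells whether it is an index, the second
-- whether it is a slot.
leaf : Bool → Bool → Misfit
leaf false true = plus 0
leaf true false = minus 0
leaf _ _ = none

-- mate h q c d matches the slots in [c, d) with the indices in [0, q), up to one misfit. Slots and
-- indices of equal parity are matched recursively; opposite misfits of the two halves are paired.
misfit : (h q c d : ℕ) → Misfit
misfit zero q c d = leaf (0 <ᵇ q) (inside c d 0)
misfit (suc h) q c d =
  merge (misfit h ⌈ q /2⌉ ⌈ c /2⌉ ⌈ d /2⌉) (misfit h ⌊ q /2⌋ ⌊ c /2⌋ ⌊ d /2⌋)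

mate : (h q c d : ℕ) → ℕ → ℕ
mate zero q c d = id
mate (suc h) q c d =
  interleave (mate h ⌈ q /2⌉ ⌈ c /2⌉ ⌈ d /2⌉) (mate h ⌊ q /2⌋ ⌊ c /2⌋ ⌊ d /2⌋)
  ∘ crossing (misfit h ⌈ q /2⌉ ⌈ c /2⌉ ⌈ d /2⌉) (misfit h ⌊ q /2⌋ ⌊ c /2⌋ ⌊ d /2⌋)

-- An explicit inverse serves twice: it finds the slot of a given index in `listing-complete`, and
-- it pulls changed indices back to slots in `listing-stable`.
unmate : (h q c d : ℕ) → ℕ → ℕ
unmate zero q c d = id
unmate (suc h) q c d =
  crossing (misfit h ⌈ q /2⌉ ⌈ c /2⌉ ⌈ d /2⌉) (misfit h ⌊ q /2⌋ ⌊ c /2⌋ ⌊ d /2⌋)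
  ∘ interleave (unmate h ⌈ q /2⌉ ⌈ c /2⌉ ⌈ d /2⌉) (unmate h ⌊ q /2⌋ ⌊ c /2⌋ ⌊ d /2⌋)

interleave-inverse : ∀ {f g f′ g′} → (∀ x → f′ (f x) ≡ x) → (∀ x → g′ (g x) ≡ x) →
  ∀ x → interleave f′ g′ (interleave f g x) ≡ x
interleave-inverse {f} {g} f′f g′g x
  rewrite half-join (Sum.map f g (half x)) with half x | join-half x
... | inj₁ y | eq = trans (cong (λ z → z + z) (f′f y)) eq
... | inj₂ y | eq = trans (cong (λ z → suc (z + z)) (g′g y)) eq

unmate-mate : ∀ h q c d x → unmate h q c d (mate h q c d x) ≡ x
unmate-mate zero q c d x = refl
unmate-mate (suc h) q c d x =
  trans (cong (crossing m n) (interleave-inverse (unmate-mate h _ _ _) (unmate-mate h _ _ _) _))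
        (crossing-involutive m n x)
  where
  m = misfit h ⌈ q /2⌉ ⌈ c /2⌉ ⌈ d /2⌉
  n = misfit h ⌊ q /2⌋ ⌊ c /2⌋ ⌊ d /2⌋

mate-unmate : ∀ h q c d j → mate h q c d (unmate h q c d j) ≡ j
mate-unmate zero q c d x = refl
mate-unmate (suc h) q c d x =
  trans (cong (interleave _ _) (crossing-involutive m n _))
        (interleave-inverse (mate-unmate h _ _ _) (mate-unmate h _ _ _) x)
  where
  m = misfit h ⌈ q /2⌉ ⌈ c /2⌉ ⌈ d /2⌉
  n = misfit h ⌊ q /2⌋ ⌊ c /2⌋ ⌊ d /2⌋

-- Balance between slots and indices

Size : (s t : ℕ) → Misfit → Set
Size s t none = s ≡ t
Size s t (plus _) = suc s ≡ t
Size s t (minus _) = s ≡ suc t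

-- The d - c slots and the q indices differ in number by at most one. Here and in the uses of `Size`
-- the comparison is between q + c and d, which avoids subtraction.
record Balanced (h q c d : ℕ) : Set where
  constructor balanced
  field
    q-bound : q ≤ 2 ^ h
    d-bound : d ≤ 2 ^ h
    c≤d : c ≤ d
    deficit≤1 : q + c ≤ suc d
    surplus≤1 : d ≤ suc (q + c)

⌈n/2⌉≤1+⌊n/2⌋ : ∀ n → ⌈ n /2⌉ ≤ suc ⌊ n /2⌋
⌈n/2⌉≤1+⌊n/2⌋ zero = z≤n
⌈n/2⌉≤1+⌊n/2⌋ (suc zero) = ≤-refl
⌈n/2⌉≤1+⌊n/2⌋ (suc (suc n)) = s≤s (⌈n/2⌉≤1+⌊n/2⌋ n)

⌈n/2⌉+⌊n/2⌋≡n : ∀ n → ⌈ n /2⌉ + ⌊ n /2⌋ ≡ n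
⌈n/2⌉+⌊n/2⌋≡n n = trans (+-comm ⌈ n /2⌉ ⌊ n /2⌋) (⌊n/2⌋+⌈n/2⌉≡n n)

+-interchange : ∀ a b c d → (a + b) + (c + d) ≡ (a + c) + (b + d)
+-interchange = solve-∀

halves-sum : ∀ m n → (⌈ m /2⌉ + ⌈ n /2⌉) + (⌊ m /2⌋ + ⌊ n /2⌋) ≡ m + n
halves-sum m n = trans (+-interchange ⌈ m /2⌉ ⌈ n /2⌉ ⌊ m /2⌋ ⌊ n /2⌋)
  (cong₂ _+_ (⌈n/2⌉+⌊n/2⌋≡n m) (⌈n/2⌉+⌊n/2⌋≡n n))

-- If a were at least c + 2, the implication would give d ≤ b, and the totals would differ by two.
-- It is applied with the two parity classes as summands.
+-≤-1+-split : ∀ {a b c d} → a + b ≤ suc (c + d) → (suc (suc c) ≤ a → d ≤ b) → a ≤ suc c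
+-≤-1+-split {a} {b} {c} {d} ab≤ imp = ≮⇒≥ λ 2+c≤a →
  <-irrefl refl (≤-trans (+-mono-≤ 2+c≤a (imp 2+c≤a)) ab≤)

n≤m+m⇒⌈n/2⌉≤m : ∀ {n m} → n ≤ m + (m + 0) → ⌈ n /2⌉ ≤ m
n≤m+m⇒⌈n/2⌉≤m {n} {m} n≤ = subst (⌈ n /2⌉ ≤_) (sym (n≡⌈n+n/2⌉ m))
  (⌈n/2⌉-mono (subst (n ≤_) (cong (m +_) (+-identityʳ m)) n≤))

module _ {h q c d} (b : Balanced (suc h) q c d) where
  open Balanced b

  private
    q+c : (⌈ q /2⌉ + ⌈ c /2⌉) + (⌊ q /2⌋ + ⌊ c /2⌋) ≡ q + c
    q+c = halves-sum q c

    low≤high : ⌊ q /2⌋ + ⌊ c /2⌋ ≤ ⌈ q /2⌉ + ⌈ c /2⌉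
    low≤high = +-mono-≤ (⌊n/2⌋≤⌈n/2⌉ q) (⌊n/2⌋≤⌈n/2⌉ c)

    high≤2+low : ⌈ q /2⌉ + ⌈ c /2⌉ ≤ suc (suc (⌊ q /2⌋ + ⌊ c /2⌋))
    high≤2+low = ≤-trans (+-mono-≤ (⌈n/2⌉≤1+⌊n/2⌋ q) (⌈n/2⌉≤1+⌊n/2⌋ c))
      (≤-reflexive (cong suc (+-suc ⌊ q /2⌋ ⌊ c /2⌋)))

    deficit : (⌈ q /2⌉ + ⌈ c /2⌉) + (⌊ q /2⌋ + ⌊ c /2⌋) ≤ suc (⌈ d /2⌉ + ⌊ d /2⌋)
    deficit = subst₂ _≤_ (sym q+c) (cong suc (sym (⌈n/2⌉+⌊n/2⌋≡n d))) deficit≤1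

    surplus : ⌈ d /2⌉ + ⌊ d /2⌋ ≤ suc ((⌈ q /2⌉ + ⌈ c /2⌉) + (⌊ q /2⌋ + ⌊ c /2⌋))
    surplus = subst₂ _≤_ (sym (⌈n/2⌉+⌊n/2⌋≡n d)) (cong suc (sym q+c)) surplus≤1

    flip-+ : ∀ a b c d → a + b ≤ suc (c + d) → b + a ≤ suc (d + c)
    flip-+ a b c d = subst₂ _≤_ (+-comm a b) (cong suc (+-comm c d))

  -- The even share of q + c exceeds the odd share by 0, 1 or 2, that of d by 0 or 1. So a
  -- discrepancy of two in one class cannot be offset by an opposite one in the other class, and the
  -- totals would be out of balance.
  balanced-⌈⌉ : Balanced h ⌈ q /2⌉ ⌈ c /2⌉ ⌈ d /2⌉
  balanced-⌈⌉ = balanced (n≤m+m⇒⌈n/2⌉≤m q-bound) (n≤m+m⇒⌈n/2⌉≤m d-bound) (⌈n/2⌉-mono c≤d)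
    (+-≤-1+-split deficit
      λ 2+⌈d⌉≤ → ≤-trans (⌊n/2⌋≤⌈n/2⌉ d) (s≤s⁻¹ (s≤s⁻¹ (≤-trans 2+⌈d⌉≤ high≤2+low))))
    (+-≤-1+-split surplus
      λ 2+s≤ → ≤-trans low≤high (<⇒≤ (s≤s⁻¹ (≤-trans 2+s≤ (⌈n/2⌉≤1+⌊n/2⌋ d)))))

  balanced-⌊⌋ : Balanced h ⌊ q /2⌋ ⌊ c /2⌋ ⌊ d /2⌋
  balanced-⌊⌋ = balanced
    (≤-trans (⌊n/2⌋≤⌈n/2⌉ q) (n≤m+m⇒⌈n/2⌉≤m q-bound))
    (≤-trans (⌊n/2⌋≤⌈n/2⌉ d) (n≤m+m⇒⌈n/2⌉≤m d-bound)) (⌊n/2⌋-mono c≤d)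
    (+-≤-1+-split (flip-+ (⌈ q /2⌉ + ⌈ c /2⌉) _ ⌈ d /2⌉ _ deficit)
      λ 2+⌊d⌋≤ → ≤-trans (⌈n/2⌉≤1+⌊n/2⌋ d) (≤-trans (<⇒≤ 2+⌊d⌋≤) low≤high))
    (+-≤-1+-split (flip-+ ⌈ d /2⌉ _ (⌈ q /2⌉ + ⌈ c /2⌉) _ surplus)
      λ 2+s≤ → ≤-trans high≤2+low (≤-trans 2+s≤ (⌊n/2⌋≤⌈n/2⌉ d)))

inside-double : ∀ c d y → inside c d (y + y) ≡ inside ⌈ c /2⌉ ⌈ d /2⌉ y
inside-double c d y = cong₂ (λ u v → not u ∧ v) (double<ᵇ y c) (double<ᵇ y d)

inside-suc-double : ∀ c d y → inside c d (suc (y + y)) ≡ inside ⌊ c /2⌋ ⌊ d /2⌋ y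
inside-suc-double c d y = cong₂ (λ u v → not u ∧ v) (suc-double<ᵇ y c) (suc-double<ᵇ y d)

differ-resp : ∀ {P P′ Q Q′} m → (∀ x → P′ x ≡ P x) → (∀ x → Q′ x ≡ Q x) → Differ P Q m → Differ P′ Q′ m
differ-resp none p q e x = trans (p x) (trans (e x) (sym (q x)))
differ-resp (plus a) p q (pa , qa , e) =
  trans (p a) pa , trans (q a) qa , λ x x≢a → trans (p x) (trans (e x x≢a) (sym (q x)))
differ-resp (minus a) p q (pa , qa , e) =
  trans (p a) pa , trans (q a) qa , λ x x≢a → trans (p x) (trans (e x x≢a) (sym (q x)))


-- Two misfits of equal sign would make the totals differ by two, against the balance of the parent.
size-merge : ∀ {s₁ s₂ t₁ t₂} m n → s₁ + s₂ ≤ suc (t₁ + t₂) → t₁ + t₂ ≤ suc (s₁ + s₂) →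
  Size s₁ t₁ m → Size s₂ t₂ n → Compatible m n × Size (s₁ + s₂) (t₁ + t₂) (merge m n)
size-merge none none _ _ refl refl = none-any , refl
size-merge {s₁} none (plus _) _ _ refl refl = none-any , sym (+-suc s₁ _)
size-merge {s₁} none (minus _) _ _ refl refl = none-any , +-suc s₁ _
size-merge (plus _) none _ _ refl refl = plus-none , refl
size-merge (minus _) none _ _ refl refl = minus-none , refl
size-merge {s₁} (plus _) (minus _) _ _ refl refl = plus-minus , +-suc s₁ _
size-merge {t₁ = t₁} (minus _) (plus _) _ _ refl refl = minus-plus , sym (+-suc t₁ _)
size-merge {s₁} {s₂} (plus _) (plus _) _ t≤ refl refl =
  contradiction (subst (_≤ suc (s₁ + s₂)) (cong suc (+-suc s₁ s₂)) t≤) 1+n≰n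
size-merge {t₁ = t₁} {t₂} (minus _) (minus _) s≤ _ refl refl =
  contradiction (subst (_≤ suc (t₁ + t₂)) (cong suc (+-suc t₁ t₂)) s≤) 1+n≰n

-- `Size` has to be carried through the induction with `Differ`: it ties the sign of a misfit to
-- cardinalities, and so shows that the children's misfits are compatible.
mate-differ : ∀ h {q c d} → Balanced h q c d →
  Differ (inside c d) (λ x → mate h q c d x <ᵇ q) (misfit h q c d) × Size (q + c) d (misfit h q c d)
mate-differ zero {zero} {zero} {zero} _ = (λ _ → refl) , refl
mate-differ zero {zero} {zero} {suc zero} _ =
  (refl , refl , λ { zero 0≢0 → contradiction refl 0≢0 ; (suc _) _ → refl }) , refl
mate-differ zero {zero} {suc zero} {suc zero} _ = (λ { zero → refl ; (suc _) → refl }) , refl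
mate-differ zero {suc zero} {zero} {zero} _ =
  (refl , refl , λ { zero 0≢0 → contradiction refl 0≢0 ; (suc _) _ → refl }) , refl
mate-differ zero {suc zero} {zero} {suc zero} _ = (λ { zero → refl ; (suc _) → refl }) , refl
mate-differ zero {suc zero} {suc zero} {suc zero} _ =
  (refl , refl , λ { zero 0≢0 → contradiction refl 0≢0 ; (suc _) _ → refl }) , refl
mate-differ zero {suc (suc _)} (balanced (s≤s ()) _ _ _ _)
mate-differ zero {d = suc (suc _)} (balanced _ (s≤s ()) _ _ _)
mate-differ zero {c = suc (suc _)} {suc zero} (balanced _ _ (s≤s ()) _ _)
mate-differ (suc h) {q} {c} {d} b
  with mate-differ h (balanced-⌈⌉ b) | mate-differ h (balanced-⌊⌋ b)
... | even , even-size | odd , odd-size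
  with size-merge (misfit h ⌈ q /2⌉ ⌈ c /2⌉ ⌈ d /2⌉) (misfit h ⌊ q /2⌋ ⌊ c /2⌋ ⌊ d /2⌋)
         (subst₂ (λ s t → s ≤ suc t) (sym (halves-sum q c)) (sym (⌈n/2⌉+⌊n/2⌋≡n d)) (Balanced.deficit≤1 b))
         (subst₂ (λ s t → t ≤ suc s) (sym (halves-sum q c)) (sym (⌈n/2⌉+⌊n/2⌋≡n d)) (Balanced.surplus≤1 b))
         even-size odd-size
... | compatible , size =
  differ-merge (inside c d) (λ x → interleave π₁ π₂ x <ᵇ q) compatible
    (differ-resp m (inside-double c d) interleave-double even)
    (differ-resp n (inside-suc-double c d) interleave-suc-double odd)
  , subst₂ (λ s t → Size s t (merge m n)) (halves-sum q c) (⌈n/2⌉+⌊n/2⌋≡n d) size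
  where
  m = misfit h ⌈ q /2⌉ ⌈ c /2⌉ ⌈ d /2⌉
  n = misfit h ⌊ q /2⌋ ⌊ c /2⌋ ⌊ d /2⌋
  π₁ = mate h ⌈ q /2⌉ ⌈ c /2⌉ ⌈ d /2⌉
  π₂ = mate h ⌊ q /2⌋ ⌊ c /2⌋ ⌊ d /2⌋

  interleave-double : ∀ y → (interleave π₁ π₂ (y + y) <ᵇ q) ≡ (π₁ y <ᵇ ⌈ q /2⌉)
  interleave-double y =
    trans (cong (λ z → join (Sum.map π₁ π₂ z) <ᵇ q) (half-join (inj₁ y))) (double<ᵇ (π₁ y) q)

  interleave-suc-double : ∀ y → (interleave π₁ π₂ (suc (y + y)) <ᵇ q) ≡ (π₂ y <ᵇ ⌊ q /2⌋)
  interleave-suc-double y =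
    trans (cong (λ z → join (Sum.map π₁ π₂ z) <ᵇ q) (half-join (inj₂ y))) (suc-double<ᵇ (π₂ y) q)

<ᵇ≡true⇒< : ∀ m n → (m <ᵇ n) ≡ true → m < n
<ᵇ≡true⇒< m n eq = <ᵇ⇒< m n (subst T (sym eq) _)

<⇒<ᵇ≡true : ∀ {m n} → m < n → (m <ᵇ n) ≡ true
<⇒<ᵇ≡true {m} {n} = dec-true (m <? n)

inside-intro : ∀ {c d x} → c ≤ x → x < d → inside c d x ≡ true
inside-intro {c} {d} {x} c≤x x<d =
  cong₂ (λ u v → not u ∧ v) (dec-false (x <? c) (≤⇒≯ c≤x)) (<⇒<ᵇ≡true x<d)

inside-elim : ∀ c d x → inside c d x ≡ true → c ≤ x × x < d
inside-elim c d x eq with x <ᵇ c in x<c | x <ᵇ d in x<d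
inside-elim c d x refl | false | true =
  ≮⇒≥ (λ lt → contradiction (trans (sym (<⇒<ᵇ≡true lt)) x<c) λ ()) , <ᵇ≡true⇒< x d x<d

module _ {e p q} (p+q≤ : p + q ≤ 2 ^ e) where

  private
    -- At the root there are q slots and q indices, so `Size` leaves no room for a misfit and the
    -- matching is exact.
    inside≡ : ∀ x → inside p (p + q) x ≡ (mate e q p (p + q) x <ᵇ q)
    inside≡ with misfit e q p (p + q)
      | mate-differ e {q} {p} {p + q} (balanced (m+n≤o⇒n≤o p p+q≤) p+q≤ (m≤m+n p q)
          (m≤n⇒m≤1+n (≤-reflexive (+-comm q p))) (m≤n⇒m≤1+n (≤-reflexive (+-comm p q))))
    ... | none | differ , _ = differ
    ... | plus _ | _ , size = contradiction (trans size (+-comm p q)) 1+n≢n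
    ... | minus _ | _ , size = contradiction (trans (sym size) (+-comm q p)) 1+n≢n

  mate-< : ∀ {x} → p ≤ x → x < p + q → mate e q p (p + q) x < q
  mate-< {x} p≤x x<p+q = <ᵇ≡true⇒< _ q (trans (sym (inside≡ x)) (inside-intro p≤x x<p+q))

  unmate-inside : ∀ {j} → j < q → p ≤ unmate e q p (p + q) j × unmate e q p (p + q) j < p + q
  unmate-inside {j} j<q = inside-elim p (p + q) _ (trans (inside≡ _)
    (trans (cong (_<ᵇ q) (mate-unmate e q p (p + q) j)) (<⇒<ᵇ≡true j<q)))

-- Stability of the matching

∉-++ˡ : ∀ {xs ys : List ℕ} {x} → x ∉ xs ++ ys → x ∉ xs
∉-++ˡ x∉ = x∉ ∘ ∈-++⁺ˡ

∉-++ʳ : ∀ (xs : List ℕ) {ys x} → x ∉ xs ++ ys → x ∉ ys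
∉-++ʳ xs x∉ = x∉ ∘ ∈-++⁺ʳ xs

interleave-agree : ∀ {f g f′ g′ D₁ D₂} →
  (∀ x → x ∉ D₁ → f x ≡ f′ x) → (∀ x → x ∉ D₂ → g x ≡ g′ x) →
  ∀ x → x ∉ map (join ∘ inj₁) D₁ → x ∉ map (join ∘ inj₂) D₂ →
  interleave f g x ≡ interleave f′ g′ x
interleave-agree f≡ g≡ x x∉₁ x∉₂ with half x | join-half x
... | inj₁ y | refl = cong (λ z → z + z) (f≡ y (x∉₁ ∘ ∈-map⁺ _))
... | inj₂ y | refl = cong (λ z → suc (z + z)) (g≡ y (x∉₂ ∘ ∈-map⁺ _))

-- The old and the new crossing move at most two points each. The strict growth of the parameter sum
-- pays these 4 at the current level, while the children pay for their own shares of the sum.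
mate-cost : ∀ h {l₁ l₂ a b s₁ s₂ t₁ t₂} → l₁ + h * (4 * s₁) ≤ h * (4 * t₁) →
  l₂ + h * (4 * s₂) ≤ h * (4 * t₂) → a ≤ 2 → b ≤ 2 → s₁ + s₂ < t₁ + t₂ →
  l₁ + (l₂ + (a + b)) + suc h * (4 * (s₁ + s₂)) ≤ suc h * (4 * (t₁ + t₂))
mate-cost h {l₁} {l₂} {a} {b} {s₁} {s₂} {t₁} {t₂} l₁≤ l₂≤ a≤2 b≤2 s<t = begin
  l₁ + (l₂ + (a + b)) + suc h * (4 * (s₁ + s₂))
    ≡⟨ regroup h l₁ l₂ a b s₁ s₂ ⟩
  (l₁ + h * (4 * s₁)) + (l₂ + h * (4 * s₂)) + ((a + b) + 4 * (s₁ + s₂))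
    ≤⟨ +-mono-≤ (+-mono-≤ l₁≤ l₂≤) (+-monoˡ-≤ _ (+-mono-≤ a≤2 b≤2)) ⟩
  h * (4 * t₁) + h * (4 * t₂) + (4 + 4 * (s₁ + s₂))
    ≡⟨ cong (h * (4 * t₁) + h * (4 * t₂) +_) (sym (*-suc 4 (s₁ + s₂))) ⟩
  h * (4 * t₁) + h * (4 * t₂) + 4 * suc (s₁ + s₂)
    ≤⟨ +-monoʳ-≤ _ (*-monoʳ-≤ 4 s<t) ⟩
  h * (4 * t₁) + h * (4 * t₂) + 4 * (t₁ + t₂)
    ≡⟨ collect h t₁ t₂ ⟩
  suc h * (4 * (t₁ + t₂)) ∎
  where
  open ≤-Reasoning
  regroup : ∀ h l₁ l₂ a b s₁ s₂ → l₁ + (l₂ + (a + b)) + suc h * (4 * (s₁ + s₂)) ≡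
    (l₁ + h * (4 * s₁)) + (l₂ + h * (4 * s₂)) + ((a + b) + 4 * (s₁ + s₂))
  regroup = solve-∀
  collect : ∀ h t₁ t₂ → h * (4 * t₁) + h * (4 * t₂) + 4 * (t₁ + t₂) ≡ suc h * (4 * (t₁ + t₂))
  collect = solve-∀

halves-sum₃ : ∀ q c d →
  (⌈ q /2⌉ + ⌈ c /2⌉ + ⌈ d /2⌉) + (⌊ q /2⌋ + ⌊ c /2⌋ + ⌊ d /2⌋) ≡ q + c + d
halves-sum₃ q c d = trans
  (+-interchange (⌈ q /2⌉ + ⌈ c /2⌉) ⌈ d /2⌉ (⌊ q /2⌋ + ⌊ c /2⌋) ⌊ d /2⌋)
  (cong₂ _+_ (halves-sum q c) (⌈n/2⌉+⌊n/2⌋≡n d))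

-- Subtraction-free form of: at most 4h(Δq + Δc + Δd) changes. Halving splits Δq + Δc + Δd between
-- the parity classes, so a unit change follows a single path of the recursion.
mate-stable : ∀ h {q c d q′ c′ d′} → q ≤ q′ → c ≤ c′ → d ≤ d′ →
  ∃ λ D → length D + h * (4 * (q + c + d)) ≤ h * (4 * (q′ + c′ + d′)) ×
          (∀ x → x ∉ D → mate h q c d x ≡ mate h q′ c′ d′ x)
mate-stable zero _ _ _ = [] , z≤n , λ _ _ → refl
mate-stable (suc h) {q} {c} {d} {q′} {c′} {d′} q≤ c≤ d≤
  with m≤n⇒m<n∨m≡n (+-mono-≤ (+-mono-≤ q≤ c≤) d≤)
-- With an unchanged sum no parameter has changed, so the subtree is free. This confines the cost to
-- the paths that the change follows.
... | inj₂ eq = [] , ≤-reflexive (cong (λ s → suc h * (4 * s)) eq) , λ x _ → same x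
  where
  q≡ : q ≡ q′
  q≡ = ≤-antisym q≤ (≮⇒≥ λ lt → <-irrefl eq (+-mono-<-≤ (+-mono-<-≤ lt c≤) d≤))
  c≡ : c ≡ c′
  c≡ = ≤-antisym c≤ (≮⇒≥ λ lt → <-irrefl eq (+-mono-<-≤ (+-mono-≤-< q≤ lt) d≤))
  d≡ : d ≡ d′
  d≡ = ≤-antisym d≤ (≮⇒≥ λ lt → <-irrefl eq (+-mono-≤-< (+-mono-≤ q≤ c≤) lt))
  same : ∀ x → mate (suc h) q c d x ≡ mate (suc h) q′ c′ d′ x
  same x rewrite q≡ | c≡ | d≡ = refl
... | inj₁ s<t
  with mate-stable h (⌈n/2⌉-mono q≤) (⌈n/2⌉-mono c≤) (⌈n/2⌉-mono d≤)
     | mate-stable h (⌊n/2⌋-mono q≤) (⌊n/2⌋-mono c≤) (⌊n/2⌋-mono d≤)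
... | D₁ , l₁ , agree₁ | D₂ , l₂ , agree₂ = D , cost , agree
  where
  m = misfit h ⌈ q /2⌉ ⌈ c /2⌉ ⌈ d /2⌉
  n = misfit h ⌊ q /2⌋ ⌊ c /2⌋ ⌊ d /2⌋
  m′ = misfit h ⌈ q′ /2⌉ ⌈ c′ /2⌉ ⌈ d′ /2⌉
  n′ = misfit h ⌊ q′ /2⌋ ⌊ c′ /2⌋ ⌊ d′ /2⌋
  E₁ = map (join ∘ inj₁) D₁
  E₂ = map (join ∘ inj₂) D₂
  -- A point fixed by both crossings goes to the same child before and after, so only the child's
  -- own changes can affect it.
  D = E₁ ++ (E₂ ++ (moved m n ++ moved m′ n′))

  length-D : length D ≡ length D₁ + (length D₂ + (length (moved m n) + length (moved m′ n′)))
  length-D = trans (length-++ E₁) (cong₂ _+_ (length-map _ D₁)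
    (trans (length-++ E₂) (cong₂ _+_ (length-map _ D₂) (length-++ (moved m n)))))

  cost : length D + suc h * (4 * (q + c + d)) ≤ suc h * (4 * (q′ + c′ + d′))
  cost = subst₂ _≤_
    (cong₂ (λ l s → l + suc h * (4 * s)) (sym length-D) (halves-sum₃ q c d))
    (cong (λ s → suc h * (4 * s)) (halves-sum₃ q′ c′ d′))
    (mate-cost h {s₁ = ⌈ q /2⌉ + ⌈ c /2⌉ + ⌈ d /2⌉} {s₂ = ⌊ q /2⌋ + ⌊ c /2⌋ + ⌊ d /2⌋}
      {t₁ = ⌈ q′ /2⌉ + ⌈ c′ /2⌉ + ⌈ d′ /2⌉} {t₂ = ⌊ q′ /2⌋ + ⌊ c′ /2⌋ + ⌊ d′ /2⌋}
      l₁ l₂ (length-moved m n) (length-moved m′ n′)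
      (subst₂ _<_ (sym (halves-sum₃ q c d)) (sym (halves-sum₃ q′ c′ d′)) s<t))

  agree : ∀ x → x ∉ D → mate (suc h) q c d x ≡ mate (suc h) q′ c′ d′ x
  agree x x∉D = trans (cong (interleave _ _) (crossing-fixes m n (∉-++ˡ x∉moved)))
    (trans (interleave-agree agree₁ agree₂ x (∉-++ˡ x∉D) (∉-++ˡ (∉-++ʳ E₁ x∉D)))
      (cong (interleave _ _) (sym (crossing-fixes m′ n′ (∉-++ʳ (moved m n) x∉moved)))))
    where
    x∉moved : x ∉ moved m n ++ moved m′ n′
    x∉moved = ∉-++ʳ E₂ (∉-++ʳ E₁ x∉D)

-- Listings

bit : Bool → ℕ
bit b = if b then 1 else 0

count : ℕ → (ℕ → Bool) → ℕ
count zero χ = 0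
count (suc n) χ = bit (χ 0) + count n (χ ∘ suc)

_⊆_ : {A : Set} → (A → Bool) → (A → Bool) → Set
χ ⊆ χ′ = ∀ i → χ i ≡ true → χ′ i ≡ true

bit-mono : ∀ a b → (a ≡ true → b ≡ true) → bit a ≤ bit b
bit-mono false _ _ = z≤n
bit-mono true _ a⇒b rewrite a⇒b refl = ≤-refl

count-mono : ∀ n {χ χ′} → χ ⊆ χ′ → count n χ ≤ count n χ′
count-mono zero _ = z≤n
count-mono (suc n) {χ} {χ′} sub = +-mono-≤ (bit-mono (χ 0) (χ′ 0) (sub 0)) (count-mono n (sub ∘ suc))

count-+ : ∀ m n χ → count (m + n) χ ≡ count m χ + count n (χ ∘ (m +_))
count-+ zero n χ = refl
count-+ (suc m) n χ =
  trans (cong (bit (χ 0) +_) (count-+ m n (χ ∘ suc))) (sym (+-assoc (bit (χ 0)) _ _))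

upper : ℕ → (ℕ → Bool) → ℕ → Bool
upper h χ = χ ∘ (2 ^ h +_)

count-2^suc : ∀ h χ → count (2 ^ suc h) χ ≡ count (2 ^ h) χ + count (2 ^ h) (upper h χ)
count-2^suc h χ =
  trans (cong (λ n → count (2 ^ h + n) χ) (+-identityʳ (2 ^ h))) (count-+ (2 ^ h) (2 ^ h) χ)

glue : ℕ → (ℕ → ℕ) → (ℕ → ℕ) → ℕ → ℕ
glue p f g x with x <? p
... | yes _ = f x
... | no _ = g x

glue-< : ∀ {p f g x} → x < p → glue p f g x ≡ f x
glue-< {p} {x = x} x<p with x <? p
... | yes _ = refl
... | no x≮p = contradiction x<p x≮p

glue-≥ : ∀ {p f g x} → p ≤ x → glue p f g x ≡ g x
glue-≥ {p} {x = x} p≤x with x <? p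
... | yes x<p = contradiction p≤x (<⇒≱ x<p)
... | no _ = refl

module Listing (e : ℕ) where

  -- The left half keeps its slots [0, p), so that growing it only shifts the window [p, p + q)
  -- of the right half, at the cost given by mate-stable.
  listing : ℕ → (ℕ → Bool) → ℕ → ℕ
  listing zero χ _ = 0
  listing (suc h) χ = glue p (listing h χ) (λ x → 2 ^ h + listing h (upper h χ) (mate e q p (p + q) x))
    where
    p = count (2 ^ h) χ
    q = count (2 ^ h) (upper h χ)

  -- An element of the left half keeps its slot. One of the right half has some index there, and
  -- `unmate` turns that index into a slot of the window [p, p + q).
  listing-complete : ∀ h χ → count (2 ^ h) χ ≤ 2 ^ e → ∀ i → i < 2 ^ h → χ i ≡ true →
    ∃ λ x → x < count (2 ^ h) χ × listing h χ x ≡ i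
  listing-complete zero χ _ zero _ χi = 0 , subst (λ b → 0 < bit b + 0) (sym χi) ≤-refl , refl
  listing-complete zero χ _ (suc _) (s≤s ()) _
  listing-complete (suc h) χ small i i<2^ χi = subst (λ n → ∃ λ x → x < n × listing (suc h) χ x ≡ i)
    (sym (count-2^suc h χ)) found
    where
    p = count (2 ^ h) χ
    q = count (2 ^ h) (upper h χ)
    p+q≤ : p + q ≤ 2 ^ e
    p+q≤ = subst (_≤ 2 ^ e) (count-2^suc h χ) small
    found : ∃ λ x → x < p + q × listing (suc h) χ x ≡ i
    found with i <? 2 ^ h
    ... | yes i< with listing-complete h χ (m+n≤o⇒m≤o p p+q≤) i i< χi
    ...   | x , x<p , eq = x , ≤-trans x<p (m≤m+n p q) , trans (glue-< x<p) eq
    found | no i≮ with m≤n⇒∃[o]m+o≡n (≮⇒≥ i≮)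
    ... | i′ , refl with listing-complete h (upper h χ) (m+n≤o⇒n≤o p p+q≤) i′
                           (+-cancelˡ-< (2 ^ h) i′ (2 ^ h)
                             (subst (2 ^ h + i′ <_) (cong (2 ^ h +_) (+-identityʳ (2 ^ h))) i<2^)) χi
    ...   | j , j<q , eq = unmate e q p (p + q) j , proj₂ in-range ,
            trans (glue-≥ (proj₁ in-range))
              (cong (2 ^ h +_) (trans (cong (listing h (upper h χ)) (mate-unmate e q p (p + q) j)) eq))
      where in-range = unmate-inside {e} {p} {q} p+q≤ j<q

  -- The charge per added element and level. The parameters of `mate` sum to 2(p + q), so
  -- `mate-stable` costs 8e per element; the extra 1 pays for a slot that passes from the right half
  -- to the left.
  rate : ℕ
  rate = suc (8 * e)

  listing-cost : ∀ h {l₁ l₂ l₃ l₄ p q p′ q′} →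
    l₁ + h * (rate * p) ≤ h * (rate * p′) → l₂ + h * (rate * q) ≤ h * (rate * q′) →
    l₃ + e * (4 * (q + p + (p + q))) ≤ e * (4 * (q′ + p′ + (p′ + q′))) →
    l₄ + p ≤ p′ → q ≤ q′ →
    l₁ + (l₂ + (l₃ + l₄)) + suc h * (rate * (p + q)) ≤ suc h * (rate * (p′ + q′))
  listing-cost h {l₁} {l₂} {l₃} {l₄} {p} {q} {p′} {q′} b₁ b₂ b₃ b₄ b₅ = begin
    l₁ + (l₂ + (l₃ + l₄)) + suc h * (rate * (p + q))
      ≡⟨ regroup h e l₁ l₂ l₃ l₄ p q ⟩
    (l₁ + h * (rate * p)) + ((l₂ + h * (rate * q)) + ((l₃ + e * (4 * (q + p + (p + q)))) + ((l₄ + p) + q)))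
      ≤⟨ +-mono-≤ b₁ (+-mono-≤ b₂ (+-mono-≤ b₃ (+-mono-≤ b₄ b₅))) ⟩
    h * (rate * p′) + (h * (rate * q′) + (e * (4 * (q′ + p′ + (p′ + q′))) + (p′ + q′)))
      ≡⟨ collect h e p′ q′ ⟩
    suc h * (rate * (p′ + q′)) ∎
    where
    open ≤-Reasoning
    regroup : ∀ h e l₁ l₂ l₃ l₄ p q →
      l₁ + (l₂ + (l₃ + l₄)) + suc h * (suc (8 * e) * (p + q)) ≡
      (l₁ + h * (suc (8 * e) * p)) +
        ((l₂ + h * (suc (8 * e) * q)) + ((l₃ + e * (4 * (q + p + (p + q)))) + ((l₄ + p) + q)))
    regroup = solve-∀
    collect : ∀ h e p q →
      h * (suc (8 * e) * p) + (h * (suc (8 * e) * q) + (e * (4 * (q + p + (p + q))) + (p + q))) ≡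
      suc h * (suc (8 * e) * (p + q))
    collect = solve-∀

  -- Subtraction-free again: at most h times `rate` changes per added element. An added element lies
  -- in only one half, so the charges of the two halves add up without doubling.
  listing-stable : ∀ h {χ χ′} → χ ⊆ χ′ → count (2 ^ h) χ ≤ 2 ^ e →
    ∃ λ D → length D + h * (rate * count (2 ^ h) χ) ≤ h * (rate * count (2 ^ h) χ′) ×
            (∀ x → x < count (2 ^ h) χ → x ∉ D → listing h χ x ≡ listing h χ′ x)
  listing-stable zero _ _ = [] , z≤n , λ _ _ _ → refl
  listing-stable (suc h) {χ} {χ′} sub small
    rewrite count-2^suc h χ | count-2^suc h χ′
    with listing-stable h sub (m+n≤o⇒m≤o _ small)
       | listing-stable h {upper h χ} {upper h χ′} (sub ∘ (2 ^ h +_)) (m+n≤o⇒n≤o (count (2 ^ h) χ) small)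
       | mate-stable e (count-mono (2 ^ h) {upper h χ} {upper h χ′} (sub ∘ (2 ^ h +_)))
           (count-mono (2 ^ h) sub)
           (+-mono-≤ (count-mono (2 ^ h) sub) (count-mono (2 ^ h) {upper h χ} {upper h χ′} (sub ∘ (2 ^ h +_))))
  ... | D₁ , l₁ , agree₁ | D₂ , l₂ , agree₂ | D₃ , l₃ , agree₃ = D , cost , agree
    where
    p = count (2 ^ h) χ
    q = count (2 ^ h) (upper h χ)
    p′ = count (2 ^ h) χ′
    q′ = count (2 ^ h) (upper h χ′)
    p≤p′ : p ≤ p′
    p≤p′ = count-mono (2 ^ h) sub
    E₂ = map (unmate e q p (p + q)) D₂
    E₄ = map (p +_) (upTo (p′ ∸ p))
    -- In turn: changes of the left listing, slots whose old index has a changed entry in the right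
    -- listing, slots whose index changes, and the slots [p, p′) taken over by the left half.
    D = D₁ ++ (E₂ ++ (D₃ ++ E₄))

    length-D : length D ≡ length D₁ + (length D₂ + (length D₃ + (p′ ∸ p)))
    length-D = trans (length-++ D₁) (cong (length D₁ +_)
      (trans (length-++ E₂) (cong₂ _+_ (length-map _ D₂)
        (trans (length-++ D₃) (cong (length D₃ +_)
          (trans (length-map _ (upTo (p′ ∸ p))) (length-upTo (p′ ∸ p))))))))

    cost : length D + suc h * (rate * (p + q)) ≤ suc h * (rate * (p′ + q′))
    cost = subst (λ l → l + suc h * (rate * (p + q)) ≤ suc h * (rate * (p′ + q′))) (sym length-D)
      (listing-cost h {length D₁} {length D₂} {length D₃} {p′ ∸ p} {p} {q} {p′} {q′} l₁ l₂ l₃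
        (≤-reflexive (m∸n+n≡m p≤p′)) (count-mono (2 ^ h) (sub ∘ (2 ^ h +_))))

    agree : ∀ x → x < p + q → x ∉ D → listing (suc h) χ x ≡ listing (suc h) χ′ x
    agree x x<p+q x∉D with x <? p | x <? p′
    ... | yes x<p | yes _ = agree₁ x x<p (∉-++ˡ x∉D)
    ... | yes x<p | no x≮p′ = contradiction (≤-trans x<p p≤p′) x≮p′
    ... | no x≮p | yes x<p′ = contradiction
      (subst (_∈ E₄) (m+[n∸m]≡n (≮⇒≥ x≮p)) (∈-map⁺ (p +_) (∈-upTo⁺ (∸-monoˡ-< x<p′ (≮⇒≥ x≮p)))))
      (∉-++ʳ D₃ (∉-++ʳ E₂ (∉-++ʳ D₁ x∉D)))
    -- First the right listing is replaced at the old index, which `mate-<` keeps below q, and then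
    -- the index itself.
    ... | no x≮p | no _ = cong (2 ^ h +_)
      (trans (agree₂ _ (mate-< {e} {p} {q} small (≮⇒≥ x≮p) x<p+q) mate∉D₂)
        (cong (listing h (upper h χ′)) (agree₃ x (∉-++ˡ (∉-++ʳ E₂ (∉-++ʳ D₁ x∉D))))))
      where
      mate∉D₂ : mate e q p (p + q) x ∉ D₂
      mate∉D₂ ∈D₂ = ∉-++ˡ (∉-++ʳ D₁ x∉D)
        (subst (_∈ E₂) (unmate-mate e q p (p + q) x) (∈-map⁺ (unmate e q p (p + q)) ∈D₂))

-- Weights and Hamming distances

-- Padding with `false` allows a universe of size 2^h, which can be halved evenly.
extend : ∀ {n} → (Fin n → Bool) → ℕ → Bool
extend {zero} x _ = false
extend {suc n} x zero = x zero
extend {suc n} x (suc i) = extend (x ∘ suc) i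

extend-toℕ : ∀ {n} (x : Fin n → Bool) i → extend x (toℕ i) ≡ x i
extend-toℕ x zero = refl
extend-toℕ x (suc i) = extend-toℕ (x ∘ suc) i

extend-mono : ∀ {n} {x y : Fin n → Bool} → x ⊆ y → extend x ⊆ extend y
extend-mono {zero} sub i ()
extend-mono {suc n} sub zero = sub zero
extend-mono {suc n} sub (suc i) = extend-mono (sub ∘ suc) i

count-false : ∀ N → count N (λ _ → false) ≡ 0
count-false zero = refl
count-false (suc N) = count-false N

count-extend : ∀ {n N} (x : Fin n → Bool) → n ≤ N → count N (extend x) ≡ weight x
count-extend {N = N} x z≤n = count-false N
count-extend x (s≤s n≤N) = cong (bit (x zero) +_) (count-extend (x ∘ suc) n≤N)

weight-mono : ∀ {n} {x y : Fin n → Bool} → x ⊆ y → weight x ≤ weight y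
weight-mono {zero} _ = z≤n
weight-mono {suc n} {x} {y} sub =
  +-mono-≤ (bit-mono (x zero) (y zero) (sub zero)) (weight-mono (sub ∘ suc))

preds : List ℕ → List ℕ
preds [] = []
preds (zero ∷ L) = preds L
preds (suc i ∷ L) = i ∷ preds L

∈-preds : ∀ {i L} → suc i ∈ L → i ∈ preds L
∈-preds {L = zero ∷ L} (there p) = ∈-preds p
∈-preds {L = suc _ ∷ L} (here refl) = here refl
∈-preds {L = suc _ ∷ L} (there p) = there (∈-preds p)

length-preds : ∀ L → length (preds L) ≤ length L
length-preds [] = z≤n
length-preds (zero ∷ L) = m≤n⇒m≤1+n (length-preds L)
length-preds (suc _ ∷ L) = s≤s (length-preds L)

length-preds-< : ∀ {L} → 0 ∈ L → length (preds L) < length L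
length-preds-< {zero ∷ L} _ = s≤s (length-preds L)
length-preds-< {suc _ ∷ L} (there p) = s≤s (length-preds-< p)

-- Repetitions in `L` do no harm: when coordinate zero is set, passing to `preds L` loses at least
-- one entry, which pays for it.
weight≤length : ∀ {n} (z : Fin n → Bool) L → (∀ i → z i ≡ true → toℕ i ∈ L) → weight z ≤ length L
weight≤length {zero} z L _ = z≤n
weight≤length {suc n} z L covers
  with weight≤length (z ∘ suc) (preds L) (λ i zi → ∈-preds (covers (suc i) zi)) | z zero in z0
... | rest | true = ≤-trans (s≤s rest) (length-preds-< (covers zero z0))
... | rest | false = ≤-trans rest (length-preds L)

support : ∀ {n} → (Fin n → Bool) → List (Fin n)
support {zero} z = []
support {suc n} z = (if z zero then zero ∷ [] else []) ++ map suc (support (z ∘ suc))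

length-support : ∀ {n} (z : Fin n → Bool) → length (support z) ≡ weight z
length-support {zero} z = refl
length-support {suc n} z with z zero
... | true = cong suc (trans (length-map suc (support (z ∘ suc))) (length-support (z ∘ suc)))
... | false = trans (length-map suc (support (z ∘ suc))) (length-support (z ∘ suc))

∈-support : ∀ {n} (z : Fin n → Bool) i → z i ≡ true → i ∈ support z
∈-support z zero zi rewrite zi = here refl
∈-support z (suc i) zi =
  ∈-++⁺ʳ (if z zero then zero ∷ [] else []) (∈-map⁺ suc (∈-support (z ∘ suc) i zi))

differs : ∀ {k n} → (Fin k → Fin n) → (Fin k → Fin n) → Fin k → Bool
differs f g i = not (does (f i ≟F g i))

Ham≡weight-differs : ∀ {k n} (f g : Fin k → Fin n) → Ham _≟F_ f g ≡ weight (differs f g)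
Ham≡weight-differs {zero} f g = refl
Ham≡weight-differs {suc k} f g with does (f zero ≟F g zero)
... | true = Ham≡weight-differs (f ∘ suc) (g ∘ suc)
... | false = cong suc (Ham≡weight-differs (f ∘ suc) (g ∘ suc))

Ham≤length : ∀ {k n} (f g : Fin k → Fin n) D → (∀ i → toℕ i ∉ D → f i ≡ g i) → Ham _≟F_ f g ≤ length D
Ham≤length f g D agree = subst (_≤ length D) (sym (Ham≡weight-differs f g))
  (weight≤length (differs f g) D in-D)
  where
  in-D : ∀ i → differs f g i ≡ true → toℕ i ∈ D
  in-D i d with toℕ i ∈? D
  ... | yes i∈D = i∈D
  ... | no i∉D with f i ≟F g i
  ...   | no f≢g = contradiction (agree i i∉D) f≢g

-- For the upper bound: two k-sets with s common elements have distance 2(k - s).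
Ham-∧ : ∀ {n} (x y : Fin n → Bool) →
  Ham _≟B_ x y + 2 * weight (λ i → x i ∧ y i) ≡ weight x + weight y
Ham-∧ {zero} x y = refl
Ham-∧ {suc n} x y = trans (regroup (if does (x zero ≟B y zero) then 0 else 1) (Ham _≟B_ (x ∘ suc) (y ∘ suc))
    (bit (x zero ∧ y zero)) (weight (λ i → x (suc i) ∧ y (suc i))))
  (trans (cong₂ _+_ (bits (x zero) (y zero)) (Ham-∧ (x ∘ suc) (y ∘ suc)))
    (+-interchange (bit (x zero)) (bit (y zero)) (weight (x ∘ suc)) (weight (y ∘ suc))))
  where
  regroup : ∀ a b c d → (a + b) + 2 * (c + d) ≡ (a + 2 * c) + (b + 2 * d)
  regroup = solve-∀
  bits : ∀ a b → (if does (a ≟B b) then 0 else 1) + 2 * bit (a ∧ b) ≡ bit a + bit b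
  bits false false = refl
  bits false true = refl
  bits true false = refl
  bits true true = refl

-- For the lower bound, where the size of the union is what gets estimated.
Ham-∨ : ∀ {n} (x y : Fin n → Bool) →
  Ham _≟B_ x y + (weight x + weight y) ≡ 2 * weight (λ i → x i ∨ y i)
Ham-∨ {zero} x y = refl
Ham-∨ {suc n} x y = trans (regroup (if does (x zero ≟B y zero) then 0 else 1) (Ham _≟B_ (x ∘ suc) (y ∘ suc))
    (bit (x zero)) (weight (x ∘ suc)) (bit (y zero)) (weight (y ∘ suc)))
  (trans (cong₂ _+_ (bits (x zero) (y zero)) (Ham-∨ (x ∘ suc) (y ∘ suc)))
    (sym (*-distribˡ-+ 2 (bit (x zero ∨ y zero)) (weight (λ i → x (suc i) ∨ y (suc i))))))
  where
  regroup : ∀ a b c d e f → (a + b) + ((c + d) + (e + f)) ≡ (a + (c + e)) + (b + (d + f))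
  regroup = solve-∀
  bits : ∀ a b → (if does (a ≟B b) then 0 else 1) + (bit a + bit b) ≡ 2 * bit (a ∨ b)
  bits false false = refl
  bits false true = refl
  bits true false = refl
  bits true true = refl

n≤2^⌈log2⌉ : ∀ n (r : Acc _<_ n) → n ≤ 2 ^ ⌈log2⌉ n r
n≤2^⌈log2⌉ zero _ = z≤n
n≤2^⌈log2⌉ (suc zero) _ = ≤-refl
-- The induction follows the well-founded recursion of `⌈log2⌉`, hence the quantification over
-- accessibility proofs.
n≤2^⌈log2⌉ (suc (suc n)) (acc rs) = begin
  suc (suc n)                    ≡⟨ sym (⌊n/2⌋+⌈n/2⌉≡n (suc (suc n))) ⟩
  suc ⌊ n /2⌋ + suc ⌈ n /2⌉      ≤⟨ +-monoˡ-≤ _ (s≤s (⌊n/2⌋≤⌈n/2⌉ n)) ⟩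
  suc ⌈ n /2⌉ + suc ⌈ n /2⌉      ≡⟨ cong (suc ⌈ n /2⌉ +_) (sym (+-identityʳ _)) ⟩
  2 * suc ⌈ n /2⌉                ≤⟨ *-monoʳ-≤ 2 (n≤2^⌈log2⌉ (suc ⌈ n /2⌉) _) ⟩
  2 ^ ⌈log2⌉ (suc (suc n)) (acc rs) ∎
  where open ≤-Reasoning

n≤2^⌈log₂n⌉ : ∀ n → n ≤ 2 ^ ⌈log₂ n ⌉
n≤2^⌈log₂n⌉ n = n≤2^⌈log2⌉ n (<-wellFounded n)

toℕ-mod : ∀ {n} .{{_ : NonZero n}} (i : Fin n) → toℕ i mod n ≡ i
toℕ-mod {n} i = toℕ-injective (trans (toℕ-fromℕ< _) (m<n⇒m%n≡m (toℕ<n i)))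

-- Two comparisons cost h(8e + 1)t each and the last t slots cost t, while m = 2t. Since h and e are
-- at least 1, 16he + 2h + 1 ≤ 20he, which gives the constant 10.
stretch-cost : ∀ h e {l₁ l₂ l₃ s t m} → 1 ≤ h → 1 ≤ e →
  l₁ + h * (suc (8 * e) * s) ≤ h * (suc (8 * e) * (s + t)) →
  l₂ + h * (suc (8 * e) * s) ≤ h * (suc (8 * e) * (s + t)) →
  l₃ ≡ t → m + 2 * s ≡ (s + t) + (s + t) →
  l₁ + (l₂ + l₃) ≤ 10 * h * e * m
stretch-cost (suc h) (suc e) {l₁} {l₂} {_} {s} {t} {m} _ _ b₁ b₂ refl b₄ = begin
  l₁ + (l₂ + t)
    ≤⟨ +-mono-≤ (bound l₁ b₁) (+-monoˡ-≤ t (bound l₂ b₂)) ⟩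
  suc h * (suc (8 * suc e) * t) + (suc h * (suc (8 * suc e) * t) + t)
    -- The added term is the slack 4he - 2h - 1, written for h + 1 and e + 1 in place of h and e.
    ≤⟨ m≤m+n _ ((1 + 2 * h + 4 * e + 4 * h * e) * t) ⟩
  suc h * (suc (8 * suc e) * t) + (suc h * (suc (8 * suc e) * t) + t) + (1 + 2 * h + 4 * e + 4 * h * e) * t
    ≡⟨ collect h e t ⟩
  10 * suc h * suc e * (t + t)
    ≡⟨ cong (10 * suc h * suc e *_) (sym m≡t+t) ⟩
  10 * suc h * suc e * m ∎
  where
  open ≤-Reasoning
  collect : ∀ h e t →
    suc h * (suc (8 * suc e) * t) + (suc h * (suc (8 * suc e) * t) + t) + (1 + 2 * h + 4 * e + 4 * h * e) * t
    ≡ 10 * suc h * suc e * (t + t)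
  collect = solve-∀
  distribute : ∀ h e s t → h * (suc (8 * e) * (s + t)) ≡ h * (suc (8 * e) * t) + h * (suc (8 * e) * s)
  distribute = solve-∀
  bound : ∀ l → l + suc h * (suc (8 * suc e) * s) ≤ suc h * (suc (8 * suc e) * (s + t)) →
    l ≤ suc h * (suc (8 * suc e) * t)
  bound l b = +-cancelʳ-≤ _ l _ (≤-trans b (≤-reflexive (distribute (suc h) (suc e) s t)))
  m≡t+t : m ≡ t + t
  m≡t+t = +-cancelʳ-≡ (2 * s) m (t + t) (trans b₄ (regroup s t))
    where
    regroup : ∀ s t → (s + t) + (s + t) ≡ (t + t) + 2 * s
    regroup = solve-∀

-- The map and its two bounds

module Embedding {n k : ℕ} .{{_ : NonZero n}} (h e : ℕ) (n≤2^h : n ≤ 2 ^ h) (k≤2^e : k ≤ 2 ^ e) where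
  open Listing e

  -- Members of the set are below n, so `mod n` leaves them fixed; `φ-lists` relies on this.
  φ : H[ n ]^ k → H_⟨_⟩ k n
  φ (x , _) i = listing h (extend x) (toℕ i) mod n

  φ-lists : ∀ ((x , wx) : H[ n ]^ k) i → x i ≡ true → ∃ λ j → φ (x , wx) j ≡ i
  φ-lists (x , wx) i xi
    with listing-complete h (extend x)
           (subst (_≤ 2 ^ e) (sym (trans (count-extend x n≤2^h) wx)) k≤2^e)
           (toℕ i) (≤-trans (toℕ<n i) n≤2^h) (trans (extend-toℕ x i) xi)
  ... | j , j<count , eq = fromℕ< j<k ,
      trans (cong (_mod n) (trans (cong (listing h (extend x)) (toℕ-fromℕ< j<k)) eq)) (toℕ-mod i)
    where
    j<k : j < k
    j<k = subst (j <_) (trans (count-extend x n≤2^h) wx) j<count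

  -- Every element of A ∪ B is a value of φ A or the value of φ B at a place where they differ,
  -- so |A ∪ B| ≤ k + Ham (φ A) (φ B).
  φ-expands : ∀ (a b : H[ n ]^ k) → Ham _≟B_ (proj₁ a) (proj₁ b) ≤ 2 * Ham _≟F_ (φ a) (φ b)
  φ-expands a@(x , wx) b@(y , wy) = +-cancelʳ-≤ (k + k) _ _ (begin
    Ham _≟B_ x y + (k + k)              ≡⟨ cong₂ (λ u v → Ham _≟B_ x y + (u + v)) wx wy ⟨
    Ham _≟B_ x y + (weight x + weight y) ≡⟨ Ham-∨ x y ⟩
    2 * weight (λ i → x i ∨ y i)        ≤⟨ *-monoʳ-≤ 2 (weight≤length _ L covers) ⟩
    2 * length L                        ≡⟨ cong (2 *_) length-L ⟩
    2 * (k + Ham _≟F_ (φ a) (φ b))      ≡⟨ regroup k _ ⟩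
    2 * Ham _≟F_ (φ a) (φ b) + (k + k)  ∎)
    where
    open ≤-Reasoning
    regroup : ∀ k m → 2 * (k + m) ≡ 2 * m + (k + k)
    regroup = solve-∀
    L₁ = map (toℕ ∘ φ a) (allFin k)
    L₂ = map (toℕ ∘ φ b) (support (differs (φ a) (φ b)))
    L = L₁ ++ L₂
    length-L : length L ≡ k + Ham _≟F_ (φ a) (φ b)
    length-L = trans (length-++ L₁) (cong₂ _+_
      (trans (length-map _ (allFin k)) (length-tabulate id))
      (trans (length-map _ (support (differs (φ a) (φ b))))
        (trans (length-support (differs (φ a) (φ b))) (sym (Ham≡weight-differs (φ a) (φ b))))))
    value∈L : ∀ j → toℕ (φ b j) ∈ L
    value∈L j with φ a j ≟F φ b j in same?
    ... | yes eq = ∈-++⁺ˡ (subst (λ v → toℕ v ∈ L₁) eq (∈-map⁺ (toℕ ∘ φ a) (∈-allFin j)))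
    ... | no _ = ∈-++⁺ʳ L₁ (∈-map⁺ (toℕ ∘ φ b) (∈-support _ j (cong (not ∘ does) same?)))
    covers : ∀ i → (x i ∨ y i) ≡ true → toℕ i ∈ L
    covers i eq with x i in xi
    ... | true with φ-lists a i xi
    ...   | j , refl = ∈-++⁺ˡ (∈-map⁺ (toℕ ∘ φ a) (∈-allFin j))
    covers i eq | false with φ-lists b i eq
    ...   | j , refl = value∈L j

  count-weight : ∀ ((x , _) : H[ n ]^ k) → count (2 ^ h) (extend x) ≡ k
  count-weight (x , wx) = trans (count-extend x n≤2^h) wx

  -- Both listings are compared with that of the intersection.
  φ-stretches : 1 ≤ h → 1 ≤ e → ∀ (a b : H[ n ]^ k) →
    Ham _≟F_ (φ a) (φ b) ≤ 10 * h * e * Ham _≟B_ (proj₁ a) (proj₁ b)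
  φ-stretches 1≤h 1≤e a@(x , wx) b@(y , wy) = compare
    (listing-stable h {extend z} {extend x} (extend-mono z⊆x) small)
    (listing-stable h {extend z} {extend y} (extend-mono z⊆y) small)
    where
    z : Fin n → Bool
    z i = x i ∧ y i
    z⊆x : z ⊆ x
    z⊆x i zi with true ← x i = refl
    z⊆y : z ⊆ y
    z⊆y i zi with true ← x i = zi
    s = weight z
    -- Both sets have k elements, so t counts the elements outside the intersection in either of
    -- them.
    t = k ∸ s
    s≤k : s ≤ k
    s≤k = subst (s ≤_) wx (weight-mono z⊆x)
    s+t≡k : s + t ≡ k
    s+t≡k = m+[n∸m]≡n s≤k
    count-z : count (2 ^ h) (extend z) ≡ s
    count-z = count-extend z n≤2^h
    small : count (2 ^ h) (extend z) ≤ 2 ^ e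
    small = subst (_≤ 2 ^ e) (sym count-z) (≤-trans s≤k k≤2^e)
    Stable : (Fin n → Bool) → Set
    Stable w = ∃ λ D →
      length D + h * (rate * count (2 ^ h) (extend z)) ≤ h * (rate * count (2 ^ h) (extend w)) ×
      (∀ i → i < count (2 ^ h) (extend z) → i ∉ D → listing h (extend z) i ≡ listing h (extend w) i)
    bound : ∀ (c : H[ n ]^ k) {l} →
      l + h * (rate * count (2 ^ h) (extend z)) ≤ h * (rate * count (2 ^ h) (extend (proj₁ c))) →
      l + h * (rate * s) ≤ h * (rate * (s + t))
    bound c {l} = subst₂ (λ u v → l + h * (rate * u) ≤ h * (rate * v)) count-z (trans (count-weight c) (sym s+t≡k))
    compare : Stable x → Stable y → Ham _≟F_ (φ a) (φ b) ≤ 10 * h * e * Ham _≟B_ x y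
    compare (D₁ , l₁ , agree₁) (D₂ , l₂ , agree₂) = begin
      Ham _≟F_ (φ a) (φ b) ≤⟨ Ham≤length (φ a) (φ b) D agree ⟩
      length D             ≡⟨ length-D ⟩
      length D₁ + (length D₂ + t)
        ≤⟨ stretch-cost h e 1≤h 1≤e (bound a l₁) (bound b l₂) refl
             (trans (Ham-∧ x y) (cong₂ _+_ (trans wx (sym s+t≡k)) (trans wy (sym s+t≡k)))) ⟩
      10 * h * e * Ham _≟B_ x y ∎
      where
      open ≤-Reasoning
      -- The listing of the intersection gives no information on the slots from s to k - 1, so all
      -- of them are counted as changed.
      D₃ = map (s +_) (upTo t)
      D = D₁ ++ (D₂ ++ D₃)
      length-D : length D ≡ length D₁ + (length D₂ + t)
      length-D = trans (length-++ D₁) (cong (length D₁ +_) (trans (length-++ D₂)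
        (cong (length D₂ +_) (trans (length-map _ (upTo t)) (length-upTo t)))))
      agree : ∀ i → toℕ i ∉ D → φ a i ≡ φ b i
      agree i i∉D with toℕ i <? s
      ... | yes i<s = cong (_mod n) (trans (sym (agree₁ (toℕ i) i<count (∉-++ˡ i∉D)))
                                           (agree₂ (toℕ i) i<count (∉-++ˡ (∉-++ʳ D₁ i∉D))))
        where
        i<count : toℕ i < count (2 ^ h) (extend z)
        i<count = subst (toℕ i <_) (sym count-z) i<s
      ... | no i≮s = contradiction
        (subst (_∈ D₃) (m+[n∸m]≡n (≮⇒≥ i≮s)) (∈-map⁺ (s +_) (∈-upTo⁺ (∸-monoˡ-< (toℕ<n i) (≮⇒≥ i≮s)))))
        (∉-++ʳ D₂ (∉-++ʳ D₁ i∉D))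

theorem4 : Σ ℕ λ C → 1 ≤ C × (∀ (n k : ℕ) → 2 ≤ k → k ≤ n →
    Σ (H[ n ]^ k → H_⟨_⟩ k n) λ φ → ∀ (x y : H[ n ]^ k) →
    (Ham _≟B_ (proj₁ x) (proj₁ y) ≤ 2 * Ham _≟F_ (φ x) (φ y))
    × (Ham _≟F_ (φ x) (φ y) ≤ C * ⌈log₂ n ⌉ * ⌈log₂ k ⌉ * Ham _≟B_ (proj₁ x) (proj₁ y)))
theorem4 = 10 , s≤s z≤n , λ n k 2≤k k≤n →
  let instance
        n≢0 : NonZero n
        n≢0 = >-nonZero (≤-trans (s≤s z≤n) (≤-trans 2≤k k≤n))
      open Embedding {n} {k} ⌈log₂ n ⌉ ⌈log₂ k ⌉ (n≤2^⌈log₂n⌉ n) (n≤2^⌈log₂n⌉ k)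
  in φ , λ x y → φ-expands x y ,
       -- As ⌈log₂ 2⌉ computes to 1, monotonicity makes both logarithms at least 1.
       φ-stretches (⌈log₂⌉-mono-≤ (≤-trans 2≤k k≤n)) (⌈log₂⌉-mono-≤ 2≤k) x y
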